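{- Let $M=(S,v)$ be a model for the logic BH4, let $\varphi$ be a well-formed formula, and let $\Gamma_{\mathrm{BH4}}(M,\varphi)$ be the BH4 semantic game. Then: \begin{itemize} \item Verifier has a dominant winning strategy in $\Gamma_{\mathrm{BH4}}(M,\varphi)$ if and only if $\varphi$ is true in $M$ (has value $T$); \item Falsifier has a dominant winning strategy in $\Gamma_{\mathrm{BH4}}(M,\varphi)$ if and only if $\varphi$ is false in $M$ (has value $F$); \item Dominator has a dominant winning strategy in $\Gamma_{\mathrm{BH4}}(M,\varphi)$ if and only if $\varphi$ is nonsense in $M$ (has value $N$); \item Dictator has a dominant winning strategy in $\Gamma_{\mathrm{BH4}}(M,\varphi)$ if and only if $\varphi$ is super in $M$ (has value $S$). \end{itemize}
   Context: Formulas: $\varphi := p \mid \neg\varphi \mid \varphi\wedge\varphi \mid \varphi\vee\varphi$, with $p$ in a countable set $\mathbf{P}$ of propositional variables (atoms). Logic BH4: truth values $T$ (true), $F$ (false), $N$ (nonsense), $S$ (super). Negation: $\neg T=F$, $\neg F=T$, $\neg N=N$, $\neg S=S$. For $\wedge$ and $\vee$: if at least one argument is $S$, the value is $S$; otherwise, if at least one argument is $N$, the value is $N$; on arguments in $\{T,F\}$ they are the classical conjunction and disjunction. A model is $M=(S,v)$, where the first component $S$ is a non-empty domain (not to be confused with the truth value $S$) and $v$ is a valuation assigning truth values to formulas: arbitrary values on atoms, extended to all formulas by these tables. Game $\Gamma_{\mathrm{BH4}}(M,\varphi)$: there are four players, starting in the roles Verifier, Falsifier, Dominator, Dictator. Rules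 (given for roles): (atoms) if $\varphi$ is atomic, the game terminates; Verifier wins if $\varphi$ is true, Falsifier wins if it is false, Dominator wins if it is nonsense, Dictator wins if it is super. (negation) if $\varphi=\neg\psi$, Falsifier and Verifier switch roles, Dominator and Dictator keep their roles, and the game continues as $\Gamma_{\mathrm{BH4}}(M,\psi)$. (conjunction) if $\varphi=\chi\wedge\psi$, Falsifier, Dominator and Dictator choose between $\chi$ and $\psi$ simultaneously (and independently). (disjunction) if $\varphi=\chi\vee\psi$, Verifier, Dominator and Dictator choose between $\chi$ and $\psi$ simultaneously (and independently). (domination) Dominator's strategy strictly dominates Verifier's and Falsifier's, and Dictator's strategy strictly dominates those of all the others (there is no domination between Verifier and Falsifier). Winning strategies: where a player (in the current role) is entitled to choose, the player continues at the component he or she chose, whatever the simultaneous movers choose; where a player is not entitled to choose, play may continue at either component. A player has a winning strategy if he or she has a system of choices such that every atom that can be reached in this way is a win for that player in the role held there. "Verifier (Falsifier, Dominator, Dictator) has a winning strategy in $\Gamma_{\mathrm{BH4}}(M,\varphi)$" refers to the player holding that role at the start. A dominant winning strategy is a winning strategy that determines the truth value of $\varphi$ once played; in view of the domination rule: a winning strategy of a player is dominant if no player whose strategies strictly dominate that player's strategies has a winning strategy in the same game. So every winning strategy of Dictator is dominant; one of Dominator is dominant exactly when Dictator has no winning strategy; one of Verifier or of Falsifier is dominant exactly when neither Dominator nor Dictator has a winning strategy. -}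

module Defs where

open import Data.Product using (Σ; _×_)
open import Relation.Binary.PropositionalEquality using (_≡_)
open import Relation.Nullary using (¬_)

infix  8 ~_
infixr 7 _∧_
infixr 6 _∨_
infix  8 ¬ᵗ_
infixr 7 _∧ᵗ_
infixr 6 _∨ᵗ_

data Formula (P : Set) : Set where
  var : P → Formula P
  ~_  : Formula P → Formula P
  _∧_ : Formula P → Formula P → Formula P
  _∨_ : Formula P → Formula P → Formula P

-- True, false, nonsense, super.
data TruthValue : Set where
  T F N S : TruthValue

¬ᵗ_ : TruthValue → TruthValue
¬ᵗ T = F
¬ᵗ F = T
¬ᵗ N = N
¬ᵗ S = S

-- In both tables the clauses are tried in order, so S absorbs every value
-- and N absorbs every value but S.
_∧ᵗ_ : TruthValue → TruthValue → TruthValue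
S ∧ᵗ _ = S
_ ∧ᵗ S = S
N ∧ᵗ _ = N
_ ∧ᵗ N = N
T ∧ᵗ T = T
T ∧ᵗ F = F
F ∧ᵗ T = F
F ∧ᵗ F = F

_∨ᵗ_ : TruthValue → TruthValue → TruthValue
S ∨ᵗ _ = S
_ ∨ᵗ S = S
N ∨ᵗ _ = N
_ ∨ᵗ N = N
T ∨ᵗ T = T
T ∨ᵗ F = T
F ∨ᵗ T = T
F ∨ᵗ F = F

record Model (P : Set) : Set₁ where
  field
    Domain    : Set
    inhabited : Domain
    atoms     : P → TruthValue

  valuation : Formula P → TruthValue
  valuation (var p) = atoms p
  valuation (~ φ)   = ¬ᵗ valuation φ
  valuation (φ ∧ ψ) = valuation φ ∧ᵗ valuation ψ
  valuation (φ ∨ ψ) = valuation φ ∨ᵗ valuation ψ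

open Model public

-- A player is named by the role he or she holds at the start of the game.
data Role : Set where
  Verifier Falsifier Dominator Dictator : Role

switch : Role → Role
switch Verifier  = Falsifier
switch Falsifier = Verifier
switch Dominator = Dominator
switch Dictator  = Dictator

data Wins : Role → TruthValue → Set where
  verifier  : Wins Verifier  T
  falsifier : Wins Falsifier F
  dominator : Wins Dominator N
  dictator  : Wins Dictator  S

data Chooses∧ : Role → Set where
  falsifier : Chooses∧ Falsifier
  dominator : Chooses∧ Dominator
  dictator  : Chooses∧ Dictator

data Chooses∨ : Role → Set where
  verifier  : Chooses∨ Verifier
  dominator : Chooses∨ Dominator
  dictator  : Chooses∨ Dictator

-- s Dominates r: the strategies of the player s strictly dominate those of r.
data _Dominates_ : Role → Role → Set where
  dominator-verifier  : Dominator Dominates Verifier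
  dominator-falsifier : Dominator Dominates Falsifier
  dictator-verifier   : Dictator  Dominates Verifier
  dictator-falsifier  : Dictator  Dominates Falsifier
  dictator-dominator  : Dictator  Dominates Dominator

data Side : Set where
  left right : Side

-- A system of choices for the player currently in role r, at the formula
-- currently played: one choice at every occurrence of a conjunction or
-- disjunction at which the player is entitled to choose in the role held there.
data Strategy {P : Set} : Role → Formula P → Set where
  atom : ∀ {r p} → Strategy r (var p)
  neg  : ∀ {r φ} → Strategy (switch r) φ → Strategy r (~ φ)
  conj : ∀ {r φ ψ} → (Chooses∧ r → Side) →
         Strategy r φ → Strategy r ψ → Strategy r (φ ∧ ψ)
  disj : ∀ {r φ ψ} → (Chooses∨ r → Side) →
         Strategy r φ → Strategy r ψ → Strategy r (φ ∨ ψ)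

-- Play may continue at side d. This is vacuous when the player is not
-- entitled to choose (E is empty), so that both sides are then possible.
Permits : {E : Set} → (E → Side) → Side → Set
Permits {E} choice d = (e : E) → choice e ≡ d

-- Reaches σ s p: play following σ can end at the atom p with the player in role s.
data Reaches {P : Set} : {r : Role} {φ : Formula P} → Strategy r φ → Role → P → Set where
  atom       : ∀ {r p} → Reaches (atom {r = r} {p = p}) r p
  neg        : ∀ {r φ s p} {σ : Strategy (switch r) φ} →
               Reaches σ s p → Reaches (neg {r = r} σ) s p
  conj-left  : ∀ {r φ ψ s p c} {σ : Strategy r φ} {τ : Strategy r ψ} →
               Permits c left → Reaches σ s p → Reaches (conj c σ τ) s p
  conj-right : ∀ {r φ ψ s p c} {σ : Strategy r φ} {τ : Strategy r ψ} →
               Permits c right → Reaches τ s p → Reaches (conj c σ τ) s p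
  disj-left  : ∀ {r φ ψ s p c} {σ : Strategy r φ} {τ : Strategy r ψ} →
               Permits c left → Reaches σ s p → Reaches (disj c σ τ) s p
  disj-right : ∀ {r φ ψ s p c} {σ : Strategy r φ} {τ : Strategy r ψ} →
               Permits c right → Reaches τ s p → Reaches (disj c σ τ) s p

IsWinning : {P : Set} (M : Model P) {r : Role} {φ : Formula P} → Strategy r φ → Set
IsWinning M σ = ∀ {s p} → Reaches σ s p → Wins s (valuation M (var p))

HasWinningStrategy : {P : Set} → Model P → Formula P → Role → Set
HasWinningStrategy M φ r = Σ (Strategy r φ) λ σ → IsWinning M σ

IsDominantWinning : {P : Set} (M : Model P) {r : Role} {φ : Formula P} → Strategy r φ → Set
IsDominantWinning M {r} {φ} σ =
  IsWinning M σ × (∀ s → s Dominates r → ¬ HasWinningStrategy M φ s)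

HasDominantWinningStrategy : {P : Set} → Model P → Formula P → Role → Set
HasDominantWinningStrategy M φ r = Σ (Strategy r φ) λ σ → IsDominantWinning M σ

{-# OPTIONS --safe #-}
-- Conjunction is the maximum for T < F < N < S and disjunction the maximum for
-- F < T < N < S, and the players entitled to choose are those who do not win
-- at the least value.  Hence the player who wins at the value of φ wins by always
-- moving to the component selected by the maximum.  Conversely, if r has a winning
-- strategy, then the value of φ is won by r or by a player dominating r, who
-- in turn has a winning strategy; domination is a strict order.
module Submission where

open import Defs
open import Data.Empty using (⊥-elim)
open import Data.Nat using (ℕ)
open import Data.Product using (_×_; _,_)
open import Data.Sum using (_⊎_; inj₁; inj₂; [_,_]′)
open import Function.Base using (_∘_)
open import Function.Bundles using (_↣_; _⇔_; mk⇔)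
open import Function.Construct.Composition using (_⇔-∘_)
open import Relation.Binary.PropositionalEquality using (_≡_; refl; cong)
open import Relation.Nullary using (¬_; Irrelevant; contradiction)

data Classical : TruthValue → Set where
  true  : Classical T
  false : Classical F

-- Taking the least element as a parameter lets both connectives share their lemmas; only classical
-- `k` is meant.
data _⊑⟨_⟩_ : TruthValue → TruthValue → TruthValue → Set where
  ⊑-refl      : ∀ {k a} → a ⊑⟨ k ⟩ a
  least       : ∀ {k b} → k ⊑⟨ k ⟩ b
  classical⊑N : ∀ {k a} → Classical a → a ⊑⟨ k ⟩ N
  ⊑S          : ∀ {k a} → a ⊑⟨ k ⟩ S

-- Max k a b c: c is the maximum of a and b in the order with least element k.
data Max (k a b : TruthValue) : TruthValue → Set where
  first  : b ⊑⟨ k ⟩ a → Max k a b a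
  second : a ⊑⟨ k ⟩ b → Max k a b b

∧-max : ∀ a b → Max T a b (a ∧ᵗ b)
∧-max S b = first ⊑S
∧-max T S = second ⊑S
∧-max F S = second ⊑S
∧-max N S = second ⊑S
∧-max N T = first least
∧-max N F = first (classical⊑N false)
∧-max N N = first ⊑-refl
∧-max T N = second least
∧-max F N = second (classical⊑N false)
∧-max T T = first ⊑-refl
∧-max T F = second least
∧-max F T = first least
∧-max F F = first ⊑-refl

∨-max : ∀ a b → Max F a b (a ∨ᵗ b)
∨-max S b = first ⊑S
∨-max T S = second ⊑S
∨-max F S = second ⊑S
∨-max N S = second ⊑S
∨-max N T = first (classical⊑N true)
∨-max N F = first least
∨-max N N = first ⊑-refl
∨-max T N = second (classical⊑N true)
∨-max F N = second least
∨-max T T = first ⊑-refl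
∨-max T F = first least
∨-max F T = second least
∨-max F F = first ⊑-refl

-- The values that are compatible with r having a winning strategy.
data Attains (r : Role) (v : TruthValue) : Set where
  exact     : Wins r v → Attains r v
  overruled : ∀ {s} → s Dominates r → Wins s v → Attains r v

attains-S : ∀ r → Attains r S
attains-S Verifier  = overruled dictator-verifier dictator
attains-S Falsifier = overruled dictator-falsifier dictator
attains-S Dominator = overruled dictator-dominator dictator
attains-S Dictator  = exact dictator

-- Only Dominator and Dictator dominate anyone, and they win at `N` and `S`, so a classical value is
-- never overruled.
classical-attains⇒wins : ∀ {r v} → Classical v → Attains r v → Wins r v
classical-attains⇒wins _     (exact w)                = w
classical-attains⇒wins true  (overruled () verifier)
classical-attains⇒wins false (overruled () falsifier)

classical-wins⇒attains-N : ∀ {r v} → Classical v → Wins r v → Attains r N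
classical-wins⇒attains-N true  verifier  = overruled dominator-verifier dominator
classical-wins⇒attains-N false falsifier = overruled dominator-falsifier dominator

-- If `r` does not win at `k`, then `r` does not attain `k` either, so there is no climb from the
-- bottom; every higher step ends at `N` or `S`, where a dominating player takes over if `r` does
-- not win.
attains-mono : ∀ {k r a b} → Classical k → ¬ Wins r k → a ⊑⟨ k ⟩ b → Attains r a → Attains r b
attains-mono k¹ ¬w ⊑-refl           x = x
attains-mono k¹ ¬w least            x = contradiction (classical-attains⇒wins k¹ x) ¬w
attains-mono k¹ ¬w (classical⊑N a¹) x =
  classical-wins⇒attains-N a¹ (classical-attains⇒wins a¹ x)
attains-mono k¹ ¬w ⊑S               x = attains-S _

-- A player who wins at a classical `k` wins nowhere else, so `b` is `k`, and nothing but `k` lies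
-- below it.
wins-down : ∀ {k r a b} → Classical k → Wins r k → a ⊑⟨ k ⟩ b → Wins r b → Wins r a
wins-down k¹ wk ⊑-refl w = w
wins-down k¹ wk least  w = wk
wins-down () dominator (classical⊑N _) dominator
wins-down () dictator  ⊑S dictator

max-attains : ∀ {k r a b c} → Max k a b c → Attains r a → Attains r b → Attains r c
max-attains (first _)  x y = x
max-attains (second _) x y = y

max-attainsˡ : ∀ {k r a b c} → Classical k → ¬ Wins r k → Max k a b c → Attains r a → Attains r c
max-attainsˡ k¹ ¬w (first _)    x = x
max-attainsˡ k¹ ¬w (second a⊑b) x = attains-mono k¹ ¬w a⊑b x

max-attainsʳ : ∀ {k r a b c} → Classical k → ¬ Wins r k → Max k a b c → Attains r b → Attains r c
max-attainsʳ k¹ ¬w (first b⊑a) y = attains-mono k¹ ¬w b⊑a y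
max-attainsʳ k¹ ¬w (second _)  y = y

selected : ∀ {k a b c} → Max k a b c → Side
selected (first _)  = left
selected (second _) = right

-- E is the entitlement of the player r to choose at a connective with least value k.
module Choice {E : Set} {k r} (k¹ : Classical k) (E? : E ⊎ Wins r k)
              (E⇒¬wins : E → ¬ Wins r k) (irrelevant : Irrelevant E) where

  permits : (c : E → Side) → (e : E) → Permits c (c e)
  permits c e e′ = cong c (irrelevant e′ e)

  permits-all : Wins r k → (c : E → Side) → ∀ d → Permits c d
  permits-all w c d e = contradiction w (E⇒¬wins e)

  -- An entitled player is known to attain only the chosen component, and `attains-mono` lifts this
  -- to the maximum. Otherwise both components are reachable, and the maximum is one of them.
  choice-attains : ∀ {a b c} → Max k a b c → (f : E → Side) →
                   (Permits f left → Attains r a) → (Permits f right → Attains r b) →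
                   Attains r c
  choice-attains m f x y = [ chosen , unchosen ]′ E?
    where
    unchosen : Wins r k → Attains r _
    unchosen w = max-attains m (x (permits-all w f left)) (y (permits-all w f right))

    chosen : E → Attains r _
    -- Abstracting both together turns `permits f e` into the permission for the side matched.
    chosen e with f e | permits f e
    ... | left  | p = max-attainsˡ k¹ (E⇒¬wins e) m (x p)
    ... | right | p = max-attainsʳ k¹ (E⇒¬wins e) m (y p)

  -- If play reaches the side that was not selected, the player was not entitled to choose and so
  -- wins at `k`; `wins-down` then applies.
  selected-winsˡ : ∀ {a b c} (m : Max k a b c) → Wins r c →
                   Permits {E} (λ _ → selected m) left → Wins r a
  selected-winsˡ (first _)    w p = w
  selected-winsˡ (second a⊑b) w p =
    [ (λ e → contradiction (p e) λ ()) , (λ wk → wins-down k¹ wk a⊑b w) ]′ E?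

  selected-winsʳ : ∀ {a b c} (m : Max k a b c) → Wins r c →
                   Permits {E} (λ _ → selected m) right → Wins r b
  selected-winsʳ (second _)  w p = w
  selected-winsʳ (first b⊑a) w p =
    [ (λ e → contradiction (p e) λ ()) , (λ wk → wins-down k¹ wk b⊑a w) ]′ E?

chooses∧? : ∀ r → Chooses∧ r ⊎ Wins r T
chooses∧? Verifier  = inj₂ verifier
chooses∧? Falsifier = inj₁ falsifier
chooses∧? Dominator = inj₁ dominator
chooses∧? Dictator  = inj₁ dictator

chooses∨? : ∀ r → Chooses∨ r ⊎ Wins r F
chooses∨? Verifier  = inj₁ verifier
chooses∨? Falsifier = inj₂ falsifier
chooses∨? Dominator = inj₁ dominator
chooses∨? Dictator  = inj₁ dictator

chooses∧⇒¬wins : ∀ {r} → Chooses∧ r → ¬ Wins r T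
chooses∧⇒¬wins () verifier

chooses∨⇒¬wins : ∀ {r} → Chooses∨ r → ¬ Wins r F
chooses∨⇒¬wins () falsifier

chooses∧-irrelevant : ∀ {r} → Irrelevant (Chooses∧ r)
chooses∧-irrelevant falsifier falsifier = refl
chooses∧-irrelevant dominator dominator = refl
chooses∧-irrelevant dictator  dictator  = refl

chooses∨-irrelevant : ∀ {r} → Irrelevant (Chooses∨ r)
chooses∨-irrelevant verifier  verifier  = refl
chooses∨-irrelevant dominator dominator = refl
chooses∨-irrelevant dictator  dictator  = refl

module Choice∧ (r : Role) =
  Choice {r = r} true (chooses∧? r) chooses∧⇒¬wins chooses∧-irrelevant
module Choice∨ (r : Role) =
  Choice {r = r} false (chooses∨? r) chooses∨⇒¬wins chooses∨-irrelevant

switch-wins : ∀ {r} v → Wins r (¬ᵗ v) → Wins (switch r) v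
switch-wins T falsifier = verifier
switch-wins F verifier  = falsifier
switch-wins N dominator = dominator
switch-wins S dictator  = dictator

switch-attains : ∀ r {v} → Attains (switch r) v → Attains r (¬ᵗ v)
switch-attains Verifier  (exact falsifier) = exact verifier
switch-attains Falsifier (exact verifier)  = exact falsifier
switch-attains Dominator (exact dominator) = exact dominator
switch-attains Dictator  (exact dictator)  = exact dictator
switch-attains Verifier  (overruled dominator-falsifier dominator) =
  overruled dominator-verifier dominator
switch-attains Verifier  (overruled dictator-falsifier dictator) = attains-S Verifier
switch-attains Falsifier (overruled dominator-verifier dominator) =
  overruled dominator-falsifier dominator
switch-attains Falsifier (overruled dictator-verifier dictator) = attains-S Falsifier
switch-attains Dominator (overruled dictator-dominator dictator) = attains-S Dominator

dominates-irrefl : ∀ {r} → ¬ r Dominates r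
dominates-irrefl ()

dominates-asym : ∀ {r s} → r Dominates s → ¬ s Dominates r
dominates-asym dominator-verifier  ()
dominates-asym dominator-falsifier ()
dominates-asym dictator-verifier   ()
dominates-asym dictator-falsifier  ()
dominates-asym dictator-dominator  ()

wins-unique : ∀ {r s v} → Wins r v → Wins s v → r ≡ s
wins-unique verifier  verifier  = refl
wins-unique falsifier falsifier = refl
wins-unique dominator dominator = refl
wins-unique dictator  dictator  = refl

module _ {P : Set} (M : Model P) where

  -- `Wins` would be too strong here: at a disjunction of atoms with values `T` and `N`, Verifier
  -- has a winning strategy although the value is `N`.
  winning⇒attains : ∀ {r φ} (σ : Strategy r φ) → IsWinning M σ → Attains r (valuation M φ)
  winning⇒attains atom         win = exact (win atom)
  winning⇒attains (neg σ)      win = switch-attains _ (winning⇒attains σ (win ∘ neg))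
  winning⇒attains (conj c σ τ) win = Choice∧.choice-attains _ (∧-max _ _) c
    (λ p → winning⇒attains σ (win ∘ conj-left p))
    (λ p → winning⇒attains τ (win ∘ conj-right p))
  winning⇒attains (disj c σ τ) win = Choice∨.choice-attains _ (∨-max _ _) c
    (λ p → winning⇒attains σ (win ∘ disj-left p))
    (λ p → winning⇒attains τ (win ∘ disj-right p))

  -- The moves depend on the values alone, not on `r`, so one definition serves whichever player
  -- wins.
  select : ∀ r φ → Strategy r φ
  select r (var p) = atom
  select r (~ φ)   = neg (select (switch r) φ)
  select r (φ ∧ ψ) =
    conj (λ _ → selected (∧-max (valuation M φ) (valuation M ψ))) (select r φ) (select r ψ)
  select r (φ ∨ ψ) =
    disj (λ _ → selected (∨-max (valuation M φ) (valuation M ψ))) (select r φ) (select r ψ)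

  select-winning : ∀ {r} φ → Wins r (valuation M φ) → IsWinning M (select r φ)
  select-winning (var p) w atom    = w
  select-winning (~ φ)   w (neg q) = select-winning φ (switch-wins _ w) q
  select-winning (φ ∧ ψ) w (conj-left p q) =
    select-winning φ (Choice∧.selected-winsˡ _ (∧-max _ _) w p) q
  select-winning (φ ∧ ψ) w (conj-right p q) =
    select-winning ψ (Choice∧.selected-winsʳ _ (∧-max _ _) w p) q
  select-winning (φ ∨ ψ) w (disj-left p q) =
    select-winning φ (Choice∨.selected-winsˡ _ (∨-max _ _) w p) q
  select-winning (φ ∨ ψ) w (disj-right p q) =
    select-winning ψ (Choice∨.selected-winsʳ _ (∨-max _ _) w p) q

  dominant⇔wins : ∀ r φ → HasDominantWinningStrategy M φ r ⇔ Wins r (valuation M φ)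
  dominant⇔wins r φ = mk⇔ to from
    where
    to : HasDominantWinningStrategy M φ r → Wins r (valuation M φ)
    to (σ , win , undominated) with winning⇒attains σ win
    ... | exact w             = w
    ... | overruled {s} s≻r w =
      -- The overruling player `s` wins at the value of `φ`, so `select` is a winning strategy for
      -- `s`.
      ⊥-elim (undominated s s≻r (select s φ , select-winning φ w))

    from : Wins r (valuation M φ) → HasDominantWinningStrategy M φ r
    from w = select r φ , select-winning φ w , undominated
      where
      undominated : ∀ s → s Dominates r → ¬ HasWinningStrategy M φ s
      -- The value is won by `s` or by a player dominating `s`. Only `r` wins there, so `r` is `s`
      -- or dominates `s`; either contradicts `s≻r`.
      undominated s s≻r (σ , win) with winning⇒attains σ win
      ... | exact w′ with refl ← wins-unique w w′ = dominates-irrefl s≻r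
      ... | overruled t≻s w′ with refl ← wins-unique w w′ = dominates-asym s≻r t≻s

theorem4p2 : (P : Set) → P ↣ ℕ → (M : Model P) (φ : Formula P) →
    (HasDominantWinningStrategy M φ Verifier ⇔ valuation M φ ≡ T) ×
    (HasDominantWinningStrategy M φ Falsifier ⇔ valuation M φ ≡ F) ×
    (HasDominantWinningStrategy M φ Dominator ⇔ valuation M φ ≡ N) ×
    (HasDominantWinningStrategy M φ Dictator ⇔ valuation M φ ≡ S)
theorem4p2 P _ M φ = characterise verifier , characterise falsifier ,
                     characterise dominator , characterise dictator
  where
  wins-value-unique : ∀ {r u v} → Wins r u → Wins r v → u ≡ v
  wins-value-unique verifier  verifier  = refl
  wins-value-unique falsifier falsifier = refl
  wins-value-unique dominator dominator = refl
  wins-value-unique dictator  dictator  = refl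

  -- Each role wins at a single value, so winning at the value of `φ` amounts to an equation.
  characterise : ∀ {r v} → Wins r v → HasDominantWinningStrategy M φ r ⇔ valuation M φ ≡ v
  characterise {r} w =
    mk⇔ (λ w′ → wins-value-unique w′ w) (λ { refl → w }) ⇔-∘ dominant⇔wins M r φ
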